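{- Let $A$ be the simple graph with vertex set $\{1,2,3,4,5,6,7\}$ and exactly the following $12$ edges: $\{1,2\}$, $\{1,3\}$, $\{1,6\}$, $\{2,4\}$, $\{2,5\}$, $\{3,7\}$, $\{4,7\}$, $\{5,7\}$, $\{6,7\}$, $\{3,4\}$, $\{4,5\}$, $\{5,6\}$. Then $A$ does not admit a semi-transitive orientation.
   Context: An orientation of a simple graph assigns to each edge exactly one of its two possible directions, yielding a digraph. A digraph with vertex set $V$ and arc set $E$ is semi-transitive if it has no directed cycles and, for every directed path $v_1v_2\cdots v_k$ (distinct vertices $v_i\in V$ with arcs $v_i\to v_{i+1}$ for $1\le i<k$) with $k\ge 4$, either $v_1v_k\notin E$ or $v_iv_j\in E$ for all $1\le i<j\le k$ (where $v_iv_j$ denotes the arc directed from $v_i$ to $v_j$). A graph admits a semi-transitive orientation if some orientation of it is a semi-transitive digraph. -}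

module Defs where

open import Data.Fin.Base using (Fin; toℕ)
open import Data.Fin.Properties using (all?)
open import Data.List.Base using (List; []; _∷_)
open import Data.List.Membership.Propositional using (_∈_)
import Data.List.Membership.DecPropositional as DecMembership
open import Data.Nat.Base using (ℕ; suc; _+_)
import Data.Nat.Properties as ℕ
open import Data.Product.Base using (_×_; _,_; Σ-syntax)
open import Data.Product.Properties using (≡-dec)
open import Data.Sum.Base using (_⊎_; swap)
open import Data.Vec.Base using (Vec; head; last)
open import Data.Vec.Relation.Unary.AllPairs using (AllPairs)
open import Data.Vec.Relation.Unary.Linked using (Linked)
open import Data.Vec.Relation.Unary.Unique.Propositional using (Unique)
open import Level using (0ℓ)
open import Relation.Binary.Core using (Rel)
open import Relation.Binary.Definitions using (Symmetric)
open import Relation.Nullary.Decidable using (Dec; ¬?; _⊎-dec_; from-yes)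
open import Relation.Nullary.Negation using (¬_)

record SimpleGraph : Set₁ where
  field
    Vertex    : Set
    Adjacent  : Rel Vertex 0ℓ
    symmetric : Symmetric Adjacent
    loopless  : ∀ v → ¬ Adjacent v v

record IsOrientation (G : SimpleGraph) (Arc : Rel (SimpleGraph.Vertex G) 0ℓ) : Set where
  open SimpleGraph G
  field
    arc⇒edge    : ∀ u v → Arc u v → Adjacent u v
    exactly-one : ∀ u v → Adjacent u v →
                  (Arc u v × ¬ Arc v u) ⊎ (Arc v u × ¬ Arc u v)

module _ {V : Set} (Arc : Rel V 0ℓ) where

  IsDirectedPath : {k : ℕ} → Vec V k → Set
  IsDirectedPath vs = Unique vs × Linked Arc vs

  -- A cycle is recorded without repeating its first vertex, so a vector of
  -- length 1 is a loop and one of length 2 a pair of opposite arcs.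
  IsDirectedCycle : {n : ℕ} → Vec V (suc n) → Set
  IsDirectedCycle vs = IsDirectedPath vs × Arc (last vs) (head vs)

  -- AllPairs Arc vs: an arc from the i-th to the j-th entry whenever i < j.
  record IsSemiTransitive : Set where
    field
      acyclic    : ∀ n (vs : Vec V (suc n)) → ¬ IsDirectedCycle vs
      shortcuts  : ∀ n (vs : Vec V (4 + n)) → IsDirectedPath vs →
                   ¬ Arc (head vs) (last vs) ⊎ AllPairs Arc vs

AdmitsSemiTransitiveOrientation : SimpleGraph → Set₁
AdmitsSemiTransitiveOrientation G =
  Σ[ Arc ∈ Rel (SimpleGraph.Vertex G) 0ℓ ] IsOrientation G Arc × IsSemiTransitive Arc

edges : List (ℕ × ℕ)
edges = (1 , 2) ∷ (1 , 3) ∷ (1 , 6) ∷ (2 , 4) ∷ (2 , 5) ∷ (3 , 7)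
      ∷ (4 , 7) ∷ (5 , 7) ∷ (6 , 7) ∷ (3 , 4) ∷ (4 , 5) ∷ (5 , 6) ∷ []

-- Fin 7 counts from 0, whereas the vertices are named 1, …, 7.
label : Fin 7 → ℕ
label i = suc (toℕ i)

AdjacentA : Rel (Fin 7) 0ℓ
AdjacentA i j = (label i , label j) ∈ edges ⊎ (label j , label i) ∈ edges

adjacentA? : ∀ i j → Dec (AdjacentA i j)
adjacentA? i j = (label i , label j) ∈? edges ⊎-dec (label j , label i) ∈? edges
  where open DecMembership (≡-dec ℕ._≟_ ℕ._≟_) using (_∈?_)

A : SimpleGraph
A = record
  { Vertex    = Fin 7
  ; Adjacent  = AdjacentA
  ; symmetric = swap
  ; loopless  = from-yes (all? λ v → ¬? (adjacentA? v v))
  }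

{-# OPTIONS --safe #-}

-- Let the flow along a traversed edge be +1 or −1 according as its arc is
-- followed or opposed.  If a 4-cycle misses a chord, then no three of its
-- consecutive edges form a directed path, whichever way the fourth edge points;
-- so around it two edges go each way and its flow is 0.  Draw A in the plane:
-- the faces are four triangles and three quadrilaterals.  Each of the triangles
-- 245, 347, 567 forms with 457 a 4-cycle missing a chord, so its flow is −t if
-- t is the flow of 457.  The quadrilateral faces have flow 0, and all faces
-- together have flow 0, so t − 3t = 0.  But t is a sum of three odd numbers.
module Submission where

open import Defs
open import Data.Empty using (⊥-elim)
open import Data.Fin.Patterns
import Data.Fin.Properties as Fin
open import Data.Integer.Base using (ℤ; 0ℤ; 1ℤ; -1ℤ; _+_; _-_; -_; _*_; +_)
open import Data.Integer.Properties using (*-cancelˡ-≡)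
open import Data.Integer.Tactic.RingSolver using (solve-∀)
open import Data.Product.Base using (_×_; _,_)
open import Data.Sum.Base using (_⊎_; inj₁; inj₂; [_,_]′; swap)
open import Data.Vec.Base using ([]; _∷_)
open import Data.Vec.Relation.Unary.All using ([]; _∷_)
open import Data.Vec.Relation.Unary.AllPairs using ([]; _∷_)
open import Data.Vec.Relation.Unary.Linked using ([-]; _∷_)
open import Level using (0ℓ)
open import Relation.Binary.Core using (Rel)
open import Relation.Binary.PropositionalEquality
  using (_≡_; _≢_; refl; sym; trans; cong; cong₂; ≢-sym)
open import Relation.Nullary.Decidable using (Dec; ¬?; _×-dec_; _⊎-dec_; from-yes)
open import Relation.Nullary.Negation using (¬_)

module _ (G : SimpleGraph) where
  open SimpleGraph G

  adjacent⇒≢ : ∀ {u v} → Adjacent u v → u ≢ v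
  adjacent⇒≢ {u} uv refl = loopless u uv

  -- Consecutive vertices differ by looplessness, so distinctness is stated for opposite ones.
  -- Leaving open which chord is missing keeps the notion closed under `rotate`, which exchanges the
  -- chords, and `reverse`.
  IsNonCompleteFourCycle : (a b c d : Vertex) → Set
  IsNonCompleteFourCycle a b c d =
    Adjacent a b × Adjacent b c × Adjacent c d × Adjacent d a ×
    a ≢ c × b ≢ d × (¬ Adjacent a c ⊎ ¬ Adjacent b d)

  rotate : ∀ {a b c d} → IsNonCompleteFourCycle a b c d → IsNonCompleteFourCycle b c d a
  rotate (ab , bc , cd , da , a≢c , b≢d , inj₁ ¬ac) =
    bc , cd , da , ab , b≢d , ≢-sym a≢c , inj₂ λ ca → ¬ac (symmetric ca)
  rotate (ab , bc , cd , da , a≢c , b≢d , inj₂ ¬bd) =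
    bc , cd , da , ab , b≢d , ≢-sym a≢c , inj₁ ¬bd

  reverse : ∀ {a b c d} → IsNonCompleteFourCycle a b c d → IsNonCompleteFourCycle d c b a
  reverse (ab , bc , cd , da , a≢c , b≢d , inj₁ ¬ac) =
    symmetric cd , symmetric bc , symmetric ab , symmetric da ,
    ≢-sym b≢d , ≢-sym a≢c , inj₂ λ ca → ¬ac (symmetric ca)
  reverse (ab , bc , cd , da , a≢c , b≢d , inj₂ ¬bd) =
    symmetric cd , symmetric bc , symmetric ab , symmetric da ,
    ≢-sym b≢d , ≢-sym a≢c , inj₁ λ db → ¬bd (symmetric db)

module _ {V : Set} (Arc : Rel V 0ℓ) where

  Oriented : Rel V 0ℓ
  Oriented u v = (Arc u v × ¬ Arc v u) ⊎ (Arc v u × ¬ Arc u v)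

  -- The sign is read off the proof term, so two faces sharing an edge have to use the same proof,
  -- up to `swap`, for its flows to cancel.
  flow : ∀ {u v} → Oriented u v → ℤ
  flow (inj₁ _) = 1ℤ
  flow (inj₂ _) = -1ℤ

  flow-swap : ∀ {u v} (e : Oriented u v) → flow (swap e) ≡ - flow e
  flow-swap (inj₁ _) = refl
  flow-swap (inj₂ _) = refl

  flow-triangle≢0 : ∀ {a b c} (ab : Oriented a b) (bc : Oriented b c) (ca : Oriented c a) →
                    flow ab + flow bc + flow ca ≢ 0ℤ
  flow-triangle≢0 (inj₁ _) (inj₁ _) (inj₁ _) ()
  flow-triangle≢0 (inj₁ _) (inj₁ _) (inj₂ _) ()
  flow-triangle≢0 (inj₁ _) (inj₂ _) (inj₁ _) ()
  flow-triangle≢0 (inj₁ _) (inj₂ _) (inj₂ _) ()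
  flow-triangle≢0 (inj₂ _) (inj₁ _) (inj₁ _) ()
  flow-triangle≢0 (inj₂ _) (inj₁ _) (inj₂ _) ()
  flow-triangle≢0 (inj₂ _) (inj₂ _) (inj₁ _) ()
  flow-triangle≢0 (inj₂ _) (inj₂ _) (inj₂ _) ()

module _ {G : SimpleGraph} {Arc : Rel (SimpleGraph.Vertex G) 0ℓ}
         (orientation : IsOrientation G Arc) (semiTransitive : IsSemiTransitive Arc) where
  open SimpleGraph G
  open IsOrientation orientation
  open IsSemiTransitive semiTransitive

  -- An arc from `d` to `a` would close a directed cycle. An arc from `a` to `d` would join the ends
  -- of a directed path on four vertices, so both chords would be arcs, although one is not even an
  -- edge.
  ¬three-consecutive-arcs : ∀ {a b c d} → IsNonCompleteFourCycle G a b c d →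
                            Arc a b → Arc b c → ¬ Arc c d
  ¬three-consecutive-arcs {a} {b} {c} {d} (ab , bc , cd , da , a≢c , b≢d , missing) a→b b→c c→d =
    closing (exactly-one d a da)
    where
    path : IsDirectedPath Arc (a ∷ b ∷ c ∷ d ∷ [])
    path = ((adjacent⇒≢ G ab ∷ a≢c ∷ ≢-sym (adjacent⇒≢ G da) ∷ [])
           ∷ (adjacent⇒≢ G bc ∷ b≢d ∷ [])
           ∷ (adjacent⇒≢ G cd ∷ [])
           ∷ [] ∷ [])
         , a→b ∷ b→c ∷ c→d ∷ [-]

    closing : ¬ Oriented Arc d a
    closing (inj₁ (d→a , _)) = acyclic 3 _ (path , d→a)
    closing (inj₂ (a→d , _)) with shortcuts 0 _ path
    ... | inj₁ ¬a→d = ¬a→d a→d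
    ... | inj₂ ((_ ∷ a→c ∷ _) ∷ (_ ∷ b→d ∷ _) ∷ _) =
      [ (λ ¬ac → ¬ac (arc⇒edge a c a→c)) , (λ ¬bd → ¬bd (arc⇒edge b d b→d)) ]′ missing

  -- Of the sixteen sign patterns, six have two signs of each kind and sum to zero by computation.
  -- The other ten have three cyclically consecutive equal signs, which `¬three-consecutive-arcs`
  -- excludes.
  flow-fourCycle≡0 : ∀ {a b c d} → IsNonCompleteFourCycle G a b c d →
                     (ab : Oriented Arc a b) (bc : Oriented Arc b c)
                     (cd : Oriented Arc c d) (da : Oriented Arc d a) →
                     flow Arc ab + flow Arc bc + flow Arc cd + flow Arc da ≡ 0ℤ
  flow-fourCycle≡0 {a} {b} {c} {d} q = balance
    where
    -- The rotations let the three equal signs start at any of the four edges.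
    q₁ = rotate G q
    q₂ = rotate G q₁
    q₃ = rotate G q₂

    forward : ∀ {u v w x} → IsNonCompleteFourCycle G u v w x → {P : Set} →
              Arc u v × ¬ Arc v u → Arc v w × ¬ Arc w v → Arc w x × ¬ Arc x w → P
    forward r (u→v , _) (v→w , _) (w→x , _) = ⊥-elim (¬three-consecutive-arcs r u→v v→w w→x)

    backward : ∀ {u v w x} → IsNonCompleteFourCycle G u v w x → {P : Set} →
               Arc v u × ¬ Arc u v → Arc w v × ¬ Arc v w → Arc x w × ¬ Arc w x → P
    -- Three opposed arcs form a directed path of the reversed cycle.
    backward r v→u w→v x→w = forward (reverse G r) x→w w→v v→u

    balance : (ab : Oriented Arc a b) (bc : Oriented Arc b c)
              (cd : Oriented Arc c d) (da : Oriented Arc d a) →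
              flow Arc ab + flow Arc bc + flow Arc cd + flow Arc da ≡ 0ℤ
    balance (inj₁ e) (inj₁ f) (inj₁ g) _        = forward q e f g
    balance (inj₁ e) (inj₁ f) (inj₂ _) (inj₁ h) = forward q₃ h e f
    balance (inj₁ _) (inj₁ _) (inj₂ _) (inj₂ _) = refl
    balance (inj₁ e) (inj₂ _) (inj₁ g) (inj₁ h) = forward q₂ g h e
    balance (inj₁ _) (inj₂ _) (inj₁ _) (inj₂ _) = refl
    balance (inj₁ _) (inj₂ _) (inj₂ _) (inj₁ _) = refl
    balance (inj₁ _) (inj₂ f) (inj₂ g) (inj₂ h) = backward q₁ f g h
    balance (inj₂ _) (inj₁ f) (inj₁ g) (inj₁ h) = forward q₁ f g h
    balance (inj₂ _) (inj₁ _) (inj₁ _) (inj₂ _) = refl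
    balance (inj₂ _) (inj₁ _) (inj₂ _) (inj₁ _) = refl
    balance (inj₂ e) (inj₁ _) (inj₂ g) (inj₂ h) = backward q₂ g h e
    balance (inj₂ _) (inj₂ _) (inj₁ _) (inj₁ _) = refl
    balance (inj₂ e) (inj₂ f) (inj₁ _) (inj₂ h) = backward q₃ h e f
    balance (inj₂ e) (inj₂ f) (inj₂ g) _        = backward q e f g

isNonCompleteFourCycleA? : ∀ a b c d → Dec (IsNonCompleteFourCycle A a b c d)
isNonCompleteFourCycleA? a b c d =
  adjacentA? a b ×-dec adjacentA? b c ×-dec adjacentA? c d ×-dec adjacentA? d a ×-dec
  ¬? (a Fin.≟ c) ×-dec ¬? (b Fin.≟ d) ×-dec (¬? (adjacentA? a c) ⊎-dec ¬? (adjacentA? b d))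

-- Twice the flow of the triangle 457 is the total flow of its unions with the
-- three neighbouring triangles minus that of the three quadrilateral faces.
triangle-from-fourCycles : ∀ x₄₅ x₅₇ x₇₄ x₄₂ x₂₅ x₇₃ x₃₄ x₅₆ x₆₇ x₂₁ x₁₃ x₆₁ →
  + 2 * (x₄₅ + x₅₇ + x₇₄) ≡
  ((x₄₂ + x₂₅ + x₅₇ + x₇₄) + (x₄₅ + x₅₇ + x₇₃ + x₃₄) + (x₄₅ + x₅₆ + x₆₇ + x₇₄))
  - ((x₄₂ + x₂₁ + x₁₃ + x₃₄) + (x₂₅ + x₅₆ + x₆₁ + - x₂₁) + (x₆₇ + x₇₃ + - x₁₃ + - x₆₁))
triangle-from-fourCycles = solve-∀

theorem4 : ¬ AdmitsSemiTransitiveOrientation A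
theorem4 (Arc , orientation , semiTransitive) =
  -- Twice the flow of 457 equals `0ℤ - 0ℤ`, which computes to `+ 2 * 0ℤ`; cancelling the 2
  -- contradicts oddness.
  flow-triangle≢0 Arc e₄₅ e₅₇ e₇₄ (*-cancelˡ-≡ (+ 2) _ 0ℤ (trans
    (triangle-from-fourCycles (φ e₄₅) (φ e₅₇) (φ e₇₄) (φ e₄₂) (φ e₂₅) (φ e₇₃)
                              (φ e₃₄) (φ e₅₆) (φ e₆₇) (φ e₂₁) (φ e₁₃) (φ e₆₁))
    (cong₂ _-_ (sum₃≡0 q₄₂₅₇ q₄₅₇₃ q₄₅₆₇) (sum₃≡0 q₄₂₁₃ q₂₅₆₁ q₆₇₃₁))))
  where
  open IsOrientation orientation

  φ : ∀ {u v} → Oriented Arc u v → ℤ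
  φ = flow Arc

  sum₃≡0 : ∀ {x y z} → x ≡ 0ℤ → y ≡ 0ℤ → z ≡ 0ℤ → x + y + z ≡ 0ℤ
  sum₃≡0 refl refl refl = refl

  -- The subscripts are the paper's vertex names, so they exceed the elements of Fin 7 by one.
  e₄₅ = exactly-one 3F 4F (from-yes (adjacentA? 3F 4F))
  e₅₇ = exactly-one 4F 6F (from-yes (adjacentA? 4F 6F))
  e₇₄ = exactly-one 6F 3F (from-yes (adjacentA? 6F 3F))
  e₄₂ = exactly-one 3F 1F (from-yes (adjacentA? 3F 1F))
  e₂₅ = exactly-one 1F 4F (from-yes (adjacentA? 1F 4F))
  e₇₃ = exactly-one 6F 2F (from-yes (adjacentA? 6F 2F))
  e₃₄ = exactly-one 2F 3F (from-yes (adjacentA? 2F 3F))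
  e₅₆ = exactly-one 4F 5F (from-yes (adjacentA? 4F 5F))
  e₆₇ = exactly-one 5F 6F (from-yes (adjacentA? 5F 6F))
  e₂₁ = exactly-one 1F 0F (from-yes (adjacentA? 1F 0F))
  e₁₃ = exactly-one 0F 2F (from-yes (adjacentA? 0F 2F))
  e₆₁ = exactly-one 5F 0F (from-yes (adjacentA? 5F 0F))

  q₄₂₅₇ : φ e₄₂ + φ e₂₅ + φ e₅₇ + φ e₇₄ ≡ 0ℤ
  q₄₂₅₇ = flow-fourCycle≡0 orientation semiTransitive
    (from-yes (isNonCompleteFourCycleA? 3F 1F 4F 6F)) e₄₂ e₂₅ e₅₇ e₇₄

  q₄₅₇₃ : φ e₄₅ + φ e₅₇ + φ e₇₃ + φ e₃₄ ≡ 0ℤ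
  q₄₅₇₃ = flow-fourCycle≡0 orientation semiTransitive
    (from-yes (isNonCompleteFourCycleA? 3F 4F 6F 2F)) e₄₅ e₅₇ e₇₃ e₃₄

  q₄₅₆₇ : φ e₄₅ + φ e₅₆ + φ e₆₇ + φ e₇₄ ≡ 0ℤ
  q₄₅₆₇ = flow-fourCycle≡0 orientation semiTransitive
    (from-yes (isNonCompleteFourCycleA? 3F 4F 5F 6F)) e₄₅ e₅₆ e₆₇ e₇₄

  q₄₂₁₃ : φ e₄₂ + φ e₂₁ + φ e₁₃ + φ e₃₄ ≡ 0ℤ
  q₄₂₁₃ = flow-fourCycle≡0 orientation semiTransitive
    (from-yes (isNonCompleteFourCycleA? 3F 1F 0F 2F)) e₄₂ e₂₁ e₁₃ e₃₄

  q₂₅₆₁ : φ e₂₅ + φ e₅₆ + φ e₆₁ + - φ e₂₁ ≡ 0ℤ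
  -- This face crosses the edge 12 from 1 to 2, against `e₂₁`; the negated flow cancels the one in
  -- `q₄₂₁₃`. The edges 13 and 16 are treated likewise in `q₆₇₃₁`.
  q₂₅₆₁ = trans (cong (λ x → φ e₂₅ + φ e₅₆ + φ e₆₁ + x) (sym (flow-swap Arc e₂₁)))
    (flow-fourCycle≡0 orientation semiTransitive
      (from-yes (isNonCompleteFourCycleA? 1F 4F 5F 0F)) e₂₅ e₅₆ e₆₁ (swap e₂₁))

  q₆₇₃₁ : φ e₆₇ + φ e₇₃ + - φ e₁₃ + - φ e₆₁ ≡ 0ℤ
  q₆₇₃₁ = trans
    (cong₂ (λ x y → φ e₆₇ + φ e₇₃ + x + y) (sym (flow-swap Arc e₁₃)) (sym (flow-swap Arc e₆₁)))
    (flow-fourCycle≡0 orientation semiTransitive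
      (from-yes (isNonCompleteFourCycleA? 5F 6F 2F 0F)) e₆₇ e₇₃ (swap e₁₃) (swap e₆₁))
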